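{- Let $A\subseteq\omega^\omega$ be a $\mathsf{W}$-selfdual set. Then there is a map $\psi:\mathscr{P}(\omega)\to[A]_{\mathsf{W}}$ such that for every $X,Y\subseteq\omega$: (1) if $X\subseteq^*Y$, then $\psi(X)\leq_{\mathsf{L}(d_0)}\psi(Y)$; (2) if $\psi(X)\leq_{\mathsf{Lip}(d_0)}\psi(Y)$, then $X\subseteq^*Y$.
   Context: Base theory: $\mathsf{ZF}+\mathsf{DC}(\mathbb{R})$. $\omega^\omega$ is the Baire space with its product topology and standard metric $d(x,y)=0$ if $x=y$ and $d(x,y)=2^{ -n}$ if $x\neq y$ and $n$ is least with $x(n)\neq y(n)$. The metric $d_0$ on $\omega^\omega$ is defined by: $d_0(x,y)=0$ if $x=y$; $d_0(x,y)=d(x,y)$ if $x(0)=y(0)$; $d_0(x,y)=\max\{x(0),y(0)\}$ if $x(0)\neq y(0)$. $\mathsf{W}$ is the set of continuous functions $\omega^\omega\to\omega^\omega$. $\mathsf{L}(d_0)$ is the set of $f:\omega^\omega\to\omega^\omega$ with $d_0(f(x),f(y))\leq d_0(x,y)$ for all $x,y$; $\mathsf{Lip}(d_0)$ is the set of $f$ for which there is a real $L\geq 0$ with $d_0(f(x),f(y))\leq L\cdot d_0(x,y)$ for all $x,y$. For a set of functions $\mathcal{F}$ and $A,B\subseteq\omega^\omega$, $A\leq_{\mathcal{F}}B$ iff $A=f^{ -1}(B)$ for some $f\in\mathcal{F}$; $A\equiv_{\mathcal F}B$ iff $A\leq_{\mathcal F}B\leq_{\mathcal F}A$; $[A]_{\mathsf{W}}=\{B\subseteq\omega^\omega: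 B\equiv_{\mathsf{W}}A\}$. $A$ is $\mathsf{W}$-selfdual if $A\leq_{\mathsf{W}}\omega^\omega\setminus A$. For $X,Y\subseteq\omega$, $X\subseteq^*Y$ iff $X\setminus Y$ is finite. -}

module Defs where

open import Axiom.ExcludedMiddle using (ExcludedMiddle)
open import Data.Integer.Base using (+_)
open import Data.List.Base using (List)
open import Data.List.Membership.Propositional using (_∈_)
open import Data.Nat.Base as ℕ using (ℕ; zero; suc; _⊔_)
open import Data.Nat.Induction using (<-rec)
import Data.Nat.Properties as ℕₚ
open import Data.Product.Base using (∃; _×_; _,_; proj₁; proj₂)
open import Data.Rational.Base
  using (ℚ; 0ℚ; 1ℚ; ½; _+_; _*_; _-_; -_; ∣_∣; 1/_; _/_; _≤_; _<_; Positive; NonZero; positive)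
open import Data.Rational.Properties
open import Level using (0ℓ)
open import Relation.Binary.Core using (Rel)
open import Relation.Binary.Definitions using (_Respects_)
open import Relation.Binary.PropositionalEquality
  using (_≡_; _≢_; _≗_; refl; sym; trans; cong; subst)
open import Relation.Nullary using (¬_; yes; no)
open import Relation.Nullary.Decidable using (decidable-stable)
open import Relation.Unary using (Pred; _≐_; _∖_; _⊢_; ∁)

-- Excluded middle is a hypothesis of the theorem, and a parameter of the few
-- definitions (the metrics) that decide equality of points of the Baire space.

------------------------------------------------------------------------
-- Subsets of ω

Finite : Pred ℕ 0ℓ → Set
Finite P = ∃ λ (xs : List ℕ) → P ≐ (_∈ xs)

infix 4 _⊆*_

_⊆*_ : Rel (Pred ℕ 0ℓ) 0ℓ
X ⊆* Y = Finite (X ∖ Y)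

------------------------------------------------------------------------
-- Real numbers

-- A real is represented by a Cauchy sequence of rationals.
record ℝ : Set where
  constructor mkℝ
  field
    seq    : ℕ → ℚ
    cauchy : ∀ ε → 0ℚ < ε →
             ∃ λ N → ∀ m n → N ℕ.≤ m → N ℕ.≤ n → ∣ seq m - seq n ∣ < ε

open ℝ public

infix 4 _≤ℝ_

-- The order on the limits: lim u ≤ lim v iff, for every ε > 0, u n ≤ v n + ε
-- for all large n.
_≤ℝ_ : Rel ℝ 0ℓ
u ≤ℝ v = ∀ ε → 0ℚ < ε → ∃ λ N → ∀ n → N ℕ.≤ n → seq u n ≤ seq v n + ε

fromℚ : ℚ → ℝ
fromℚ q = mkℝ (λ _ → q) λ ε 0<ε → 0 , λ _ _ _ _ →
  subst (λ r → ∣ r ∣ < ε) (sym (+-inverseʳ q)) 0<ε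

infixl 7 _·_

_·_ : ℝ → ℚ → ℝ
u · q = mkℝ (λ n → seq u n * q) λ ε 0<ε →
  let δ   = ε * c⁻¹
      0<δ = positive⁻¹ δ {{pos*pos⇒pos ε {{positive 0<ε}} c⁻¹ {{1/pos⇒pos c}}}}
      N , close = cauchy u δ 0<δ
  in N , λ m n N≤m N≤n → bound ε (seq u m) (seq u n) (close m n N≤m N≤n)
  where
  instance
    _ = ∣-∣-nonNeg q

    c-pos : Positive (∣ q ∣ + 1ℚ)
    c-pos = nonNeg+pos⇒pos ∣ q ∣ 1ℚ

    c-nonZero : NonZero (∣ q ∣ + 1ℚ)
    c-nonZero = pos⇒nonZero (∣ q ∣ + 1ℚ)

  c c⁻¹ : ℚ
  c   = ∣ q ∣ + 1ℚ
  c⁻¹ = 1/ c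

  factor : ∀ a b → a * q - b * q ≡ (a - b) * q
  factor a b = sym (trans (*-distribʳ-+ q a (- b))
                          (cong (_+_ (a * q)) (sym (neg-distribˡ-* b q))))

  bound : ∀ ε a b → ∣ a - b ∣ < ε * c⁻¹ → ∣ a * q - b * q ∣ < ε
  bound ε a b a≈b = begin-strict
    ∣ a * q - b * q ∣  ≡⟨ cong ∣_∣ (factor a b) ⟩
    ∣ (a - b) * q ∣    ≡⟨ ∣p*q∣≡∣p∣*∣q∣ (a - b) q ⟩
    ∣ a - b ∣ * ∣ q ∣  ≤⟨ *-monoˡ-≤-nonNeg ∣ a - b ∣ {{∣-∣-nonNeg (a - b)}} ∣q∣≤c ⟩
    ∣ a - b ∣ * c      <⟨ *-monoˡ-<-pos c a≈b ⟩
    ε * c⁻¹ * c        ≡⟨ *-assoc ε c⁻¹ c ⟩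
    ε * (c⁻¹ * c)      ≡⟨ cong (ε *_) (*-inverseˡ c) ⟩
    ε * 1ℚ             ≡⟨ *-identityʳ ε ⟩
    ε                  ∎
    where
    open ≤-Reasoning
    ∣q∣≤c : ∣ q ∣ ≤ c
    ∣q∣≤c = subst (_≤ c) (+-identityʳ ∣ q ∣)
      (+-monoʳ-≤ ∣ q ∣ (nonNegative⁻¹ 1ℚ))

------------------------------------------------------------------------
-- The Baire space

-- Equality of points is pointwise equality _≗_.
Baire : Set
Baire = ℕ → ℕ

½^ : ℕ → ℚ
½^ zero    = 1ℚ
½^ (suc n) = ½ * ½^ n

LeastDifference : Baire → Baire → Pred ℕ 0ℓ
LeastDifference x y n = x n ≢ y n × (∀ m → m ℕ.< n → x m ≡ y m)

leastDifference : ExcludedMiddle 0ℓ → ∀ x y → ¬ (x ≗ y) → ∃ (LeastDifference x y)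
leastDifference em x y x≠y = decidable-stable em λ none →
  x≠y (<-rec (λ n → x n ≡ y n) λ n agree<n →
    decidable-stable (x n ℕₚ.≟ y n) λ xn≢yn →
      none (n , xn≢yn , λ m m<n → agree<n m<n))

-- Both metrics take rational values only.
Distance : Set
Distance = Baire → Baire → ℚ

d : ExcludedMiddle 0ℓ → Distance
d em x y with em {x ≗ y}
... | yes _   = 0ℚ
... | no  x≠y = ½^ (proj₁ (leastDifference em x y x≠y))

d₀ : ExcludedMiddle 0ℓ → Distance
d₀ em x y with em {x ≗ y} | x 0 ℕₚ.≟ y 0
... | yes _ | _     = 0ℚ
... | no  _ | yes _ = d em x y
... | no  _ | no  _ = + (x 0 ⊔ y 0) / 1

------------------------------------------------------------------------
-- Classes of functions

-- Members of each of the classes 𝖶, 𝖫 (d₀ em) and 𝖫𝗂𝗉 (d₀ em) automatically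
-- send pointwise equal arguments to pointwise equal values.
FunctionClass : Set₁
FunctionClass = Pred (Baire → Baire) 0ℓ

-- x and y lie in the same basic open set determined by the first n values.
Agree : ℕ → Rel Baire 0ℓ
Agree n x y = ∀ i → i ℕ.< n → x i ≡ y i

-- Continuity for the product topology: every basic neighbourhood of f x
-- contains the image of a basic neighbourhood of x.
𝖶 : FunctionClass
𝖶 f = ∀ x n → ∃ λ m → ∀ y → Agree m x y → Agree n (f x) (f y)

𝖫 : Distance → FunctionClass
𝖫 ρ f = ∀ x y → ρ (f x) (f y) ≤ ρ x y

𝖫𝗂𝗉 : Distance → FunctionClass
𝖫𝗂𝗉 ρ f = ∃ λ (L : ℝ) → fromℚ 0ℚ ≤ℝ L ×
  (∀ x y → fromℚ (ρ (f x) (f y)) ≤ℝ L · ρ x y)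

------------------------------------------------------------------------
-- Subsets of the Baire space and reducibility

record Pointset : Set₁ where
  constructor mkPointset
  field
    member   : Pred Baire 0ℓ
    respects : member Respects _≗_

open Pointset public

infix 8 _ᶜ

_ᶜ : Pointset → Pointset
A ᶜ = mkPointset (∁ (member A)) λ x≗y x∉A y∈A →
  x∉A (respects A (λ n → sym (x≗y n)) y∈A)

infix 4 _≤[_]_ _≡[_]_

_≤[_]_ : Pointset → FunctionClass → Pointset → Set
A ≤[ 𝓕 ] B = ∃ λ f → 𝓕 f × member A ≐ f ⊢ member B

_≡[_]_ : Pointset → FunctionClass → Pointset → Set
A ≡[ 𝓕 ] B = A ≤[ 𝓕 ] B × B ≤[ 𝓕 ] A

𝖶-selfdual : Pointset → Set
𝖶-selfdual A = A ≤[ 𝖶 ] A ᶜ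

record [_]𝖶 (A : Pointset) : Set₁ where
  constructor mkMember
  field
    ⟦_⟧   : Pointset
    equiv : ⟦_⟧ ≡[ 𝖶 ] A

open [_]𝖶 public

{-# OPTIONS --safe #-}

-- A strict contraction cannot reduce B = A ⊕ Aᶜ to itself: following it with the
-- isometry that exchanges B with its complement would give a contraction reducing
-- B to Bᶜ, and the fixed point of that contraction would lie in B iff it does not.
-- Hence the sets B behind m irrelevant digits, all Wadge equivalent to A, are
-- strictly graded by m with respect to Lipschitz reductions.
--
-- Given e : ω → ω, put into cone n the set B behind e(n) irrelevant digits. A
-- Lipschitz map for d₀ sends n to at most a constant multiple of n (or to a fixed
-- cone), so the resulting sets compare essentially as the functions e do. For X ⊆ ω
-- take e(n) = ([k ∈ X] + 2k)² with k = log log n, which grows too slowly to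
-- notice a constant factor of n, while the squares have unbounded gaps.
module Submission where

open import Defs
open import Axiom.ExcludedMiddle using (ExcludedMiddle)
open import Data.Bool.Base using (if_then_else_)
import Data.Integer.Base as ℤ
open import Data.Integer.Base using (+_)
import Data.Integer.Properties as ℤₚ
open import Data.List.Base using (filter; upTo)
open import Data.List.Extrema.Nat using (max; xs≤max)
open import Data.List.Membership.Propositional.Properties using (∈-filter⁺; ∈-filter⁻; ∈-upTo⁺)
import Data.List.Relation.Unary.All as All
open import Data.Nat.Base using (ℕ; zero; suc; _+_; _*_; _∸_; _^_; _⊔_; _≤_; _<_; z≤n; s≤s; s≤s⁻¹; ⌊_/2⌋; ⌈_/2⌉)
open import Data.Nat.Coprimality using (1-coprimeTo) renaming (sym to coprime-sym)
open import Data.Nat.Logarithm using (⌊log₂_⌋; ⌊log₂⌋-mono-≤; ⌊log₂⌊n/2⌋⌋≡⌊log₂n⌋∸1; ⌊log₂[2^n]⌋≡n)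
open import Data.Nat.Properties
open import Data.Product.Base using (Σ-syntax; ∃; _×_; _,_; proj₁; proj₂)
open import Data.Rational.Base as ℚ using (ℚ; 0ℚ; 1ℚ; ½; mkℚ)
import Data.Rational.Properties as ℚₚ
open import Data.Sum.Base using (inj₁; inj₂)
open import Function.Base using (_∘_)
open import Level using (0ℓ)
open import Relation.Binary.Definitions using (tri<; tri≈; tri>)
open import Relation.Binary.PropositionalEquality using (_≡_; _≢_; _≗_; refl; sym; trans; cong; subst; subst₂; module ≡-Reasoning)
open import Relation.Nullary using (¬_; Dec; yes; no; does; contradiction)
open import Relation.Nullary.Decidable using (decidable-stable)
open import Relation.Unary using (Pred; _≐_; _∖_; _⊢_; ∁)

-- Rational and real bounds

ι : ℕ → ℚ
ι n = + n ℚ./ 1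

ι-mkℚ : ∀ n → ι n ≡ mkℚ (+ n) 0 (coprime-sym (1-coprimeTo n))
ι-mkℚ n = ℚₚ.normalize-coprime (coprime-sym (1-coprimeTo n))

ι-mono : ∀ {m n} → m ≤ n → ι m ℚ.≤ ι n
ι-mono {m} {n} m≤n rewrite ι-mkℚ m | ι-mkℚ n =
  ℚ.*≤* (ℤₚ.*-monoʳ-≤-nonNeg (+ 1) (ℤ.+≤+ m≤n))

ι-cancel : ∀ {m n} → ι m ℚ.≤ ι n → m ≤ n
ι-cancel {m} {n} le rewrite ι-mkℚ m | ι-mkℚ n with le
... | ℚ.*≤* m≤n = ℤₚ.drop‿+≤+ (ℤₚ.*-cancelʳ-≤-pos (+ m) (+ n) (+ 1) m≤n)

ι-* : ∀ m n → ι m ℚ.* ι n ≡ ι (m * n)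
ι-* m n rewrite ι-mkℚ m | ι-mkℚ n = cong (ℚ._/ 1) (sym (ℤₚ.pos-* m n))

ι-bound : ∀ q → ∃ λ n → q ℚ.≤ ι n
ι-bound q@(mkℚ (+ n) d _) = n , subst (q ℚ.≤_) (sym (ι-mkℚ n))
  (ℚ.*≤* (ℤₚ.*-monoˡ-≤-nonNeg (+ n) (ℤ.+≤+ (s≤s z≤n))))
ι-bound q@(mkℚ (ℤ.-[1+ n ]) d _) = 0 , ℚ.*≤* ℤ.-≤+

p≤∣p∣ : ∀ p → p ℚ.≤ ℚ.∣ p ∣
p≤∣p∣ (mkℚ (+ n) d _)      = ℚₚ.≤-refl
p≤∣p∣ (mkℚ ℤ.-[1+ n ] d _) = ℚ.*≤* ℤ.-≤+

ℚ-<⇒≱ : ∀ {p q} → p ℚ.< q → ¬ (q ℚ.≤ p)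
ℚ-<⇒≱ p<q q≤p = ℚₚ.<-irrefl refl (ℚₚ.<-≤-trans p<q q≤p)

p-q+q≡p : ∀ p q → p ℚ.- q ℚ.+ q ≡ p
p-q+q≡p p q = trans (ℚₚ.+-assoc p (ℚ.- q) q)
  (trans (cong (p ℚ.+_) (ℚₚ.+-inverseˡ q)) (ℚₚ.+-identityʳ p))

≤+ε⇒≤ : ∀ {p q} → (∀ ε → 0ℚ ℚ.< ε → p ℚ.≤ q ℚ.+ ε) → p ℚ.≤ q
≤+ε⇒≤ {p} {q} p≤q+ε = ℚₚ.≮⇒≥ λ q<p →
  let m , q<m , m<p = ℚₚ.<-dense q<p
      0<m-q = subst (ℚ._< m ℚ.- q) (ℚₚ.+-inverseʳ q) (ℚₚ.+-monoˡ-< (ℚ.- q) q<m)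
      p≤m = subst (p ℚ.≤_) (trans (ℚₚ.+-comm q (m ℚ.- q)) (p-q+q≡p m q)) (p≤q+ε (m ℚ.- q) 0<m-q)
  in ℚ-<⇒≱ m<p p≤m

seq-bounded : ∀ u → ∃ λ M → ∃ λ N → ∀ n → N ≤ n → seq u n ℚ.≤ ι M
seq-bounded u =
  let N , close = cauchy u 1ℚ (ℚₚ.positive⁻¹ 1ℚ)
      M , bound = ι-bound (1ℚ ℚ.+ seq u N)
  in M , N , λ n N≤n → ℚₚ.≤-trans
    (subst (ℚ._≤ 1ℚ ℚ.+ seq u N) (p-q+q≡p (seq u n) (seq u N))
      (ℚₚ.+-monoˡ-≤ (seq u N)
        (ℚₚ.≤-trans (p≤∣p∣ (seq u n ℚ.- seq u N)) (ℚₚ.<⇒≤ (close n N N≤n ≤-refl)))))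
    bound

-- A Cauchy sequence is eventually below some natural number, which can stand in for the real
-- factor. The bound `M` depends on `u` alone, so it serves all pairs of points at once.
fromℚ-≤ℝ-· : ∀ u → ∃ λ M → ∀ p q → 0ℚ ℚ.≤ q → fromℚ p ≤ℝ u · q → p ℚ.≤ ι M ℚ.* q
fromℚ-≤ℝ-· u =
  let M , N , bound = seq-bounded u
  in M , λ p q 0≤q p≤uq → ≤+ε⇒≤ λ ε 0<ε →
    let N′ , p≤ = p≤uq ε 0<ε
        n = N ⊔ N′
    in ℚₚ.≤-trans (p≤ n (m≤n⊔m N N′))
         (ℚₚ.+-monoˡ-≤ ε (ℚₚ.*-monoʳ-≤-nonNeg q {{ℚ.nonNegative 0≤q}} (bound n (m≤m⊔n N N′))))

-- Powers of two and of one half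

n<2^n : ∀ n → n < 2 ^ n
n<2^n zero    = s≤s z≤n
n<2^n (suc n) = ≤-trans (+-mono-≤ (m^n>0 2 n) (n<2^n n)) (+-monoʳ-≤ (2 ^ n) (m≤m+n (2 ^ n) 0))

½^-pos : ∀ n → ℚ.Positive (½^ n)
½^-pos zero    = _
½^-pos (suc n) = ℚₚ.pos*pos⇒pos ½ (½^ n) {{½^-pos n}}

½^-suc-< : ∀ n → ½^ (suc n) ℚ.< ½^ n
½^-suc-< n = subst (½^ (suc n) ℚ.<_) (ℚₚ.*-identityˡ (½^ n))
  (ℚₚ.*-monoˡ-<-pos (½^ n) {{½^-pos n}} ½<1)
  where
  ½<1 : ½ ℚ.< 1ℚ
  ½<1 = ℚ.*<* (ℤ.+<+ (s≤s (s≤s z≤n)))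

½^-+-≤ : ∀ m n → ½^ (m + n) ℚ.≤ ½^ n
½^-+-≤ zero    n = ℚₚ.≤-refl
½^-+-≤ (suc m) n = ℚₚ.≤-trans (ℚₚ.<⇒≤ (½^-suc-< (m + n))) (½^-+-≤ m n)

½^-anti : ∀ {m n} → m ≤ n → ½^ n ℚ.≤ ½^ m
½^-anti {m} {n} m≤n = subst (λ k → ½^ k ℚ.≤ ½^ m) (m∸n+n≡m m≤n) (½^-+-≤ (n ∸ m) m)

½^-cancel : ∀ {m n} → ½^ n ℚ.≤ ½^ m → m ≤ n
½^-cancel {m} {n} le = ≮⇒≥ λ n<m →
  ℚ-<⇒≱ (½^-suc-< n) (ℚₚ.≤-trans le (½^-anti n<m))

2^*½^ : ∀ l n → ι (2 ^ l) ℚ.* ½^ (l + n) ≡ ½^ n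
2^*½^ zero    n = ℚₚ.*-identityˡ (½^ n)
2^*½^ (suc l) n = begin
  ι (2 * 2 ^ l) ℚ.* (½ ℚ.* h)        ≡⟨ cong (λ k → ι k ℚ.* (½ ℚ.* h)) (*-comm 2 (2 ^ l)) ⟩
  ι (2 ^ l * 2) ℚ.* (½ ℚ.* h)        ≡⟨ cong (ℚ._* (½ ℚ.* h)) (ι-* (2 ^ l) 2) ⟨
  ι (2 ^ l) ℚ.* ι 2 ℚ.* (½ ℚ.* h)    ≡⟨ ℚₚ.*-assoc (ι (2 ^ l)) (ι 2) (½ ℚ.* h) ⟩
  ι (2 ^ l) ℚ.* (ι 2 ℚ.* (½ ℚ.* h))  ≡⟨ cong (ι (2 ^ l) ℚ.*_) (ℚₚ.*-assoc (ι 2) ½ h) ⟨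
  ι (2 ^ l) ℚ.* (1ℚ ℚ.* h)           ≡⟨ cong (ι (2 ^ l) ℚ.*_) (ℚₚ.*-identityˡ h) ⟩
  ι (2 ^ l) ℚ.* h                    ≡⟨ 2^*½^ l n ⟩
  ½^ n                               ∎
  where
  open ≡-Reasoning
  h = ½^ (l + n)

-- The metric d₀

agree-mono : ∀ {m n x y} → m ≤ n → Agree n x y → Agree m x y
agree-mono m≤n agree i i<m = agree i (<-≤-trans i<m m≤n)

leastDifference-unique : ∀ {x y m n} → LeastDifference x y m → LeastDifference x y n → m ≡ n
leastDifference-unique {m = m} {n} (xm≢ym , agree<m) (xn≢yn , agree<n) with <-cmp m n
... | tri< m<n _ _ = contradiction (agree<n m m<n) xm≢ym
... | tri≈ _ m≡n _ = m≡n
... | tri> _ _ n<m = contradiction (agree<m n n<m) xn≢yn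

module Metric (em : ExcludedMiddle 0ℓ) where

  d-least : ∀ {x y n} → LeastDifference x y n → d em x y ≡ ½^ n
  d-least {x} {y} least with em {x ≗ y}
  ... | yes x≗y = contradiction (x≗y _) (proj₁ least)
  ... | no  x≠y = cong ½^ (leastDifference-unique (proj₂ (leastDifference em x y x≠y)) least)

  d₀-≗ : ∀ {x y} → x ≗ y → d₀ em x y ≡ 0ℚ
  d₀-≗ {x} {y} x≗y with em {x ≗ y} | x 0 ≟ y 0
  ... | yes _   | _ = refl
  ... | no  x≠y | _ = contradiction x≗y x≠y

  d₀-least : ∀ {x y n} → LeastDifference x y (suc n) → d₀ em x y ≡ ½^ (suc n)
  d₀-least {x} {y} least with em {x ≗ y} | x 0 ≟ y 0
  ... | yes x≗y | _        = contradiction (x≗y _) (proj₁ least)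
  ... | no  _   | yes _    = d-least least
  ... | no  _   | no x0≢y0 = contradiction (proj₂ least 0 (s≤s z≤n)) x0≢y0

  d₀-apart : ∀ {x y} → x 0 ≢ y 0 → d₀ em x y ≡ ι (x 0 ⊔ y 0)
  d₀-apart {x} {y} x0≢y0 with em {x ≗ y} | x 0 ≟ y 0
  ... | yes x≗y | _         = contradiction (x≗y 0) x0≢y0
  ... | no  _   | yes x0≡y0 = contradiction x0≡y0 x0≢y0
  ... | no  _   | no  _     = refl

  -- The index in `near` is a successor because a difference at digit 0 falls under `apart`.
  data Cases (x y : Baire) : Set where
    equal : x ≗ y → Cases x y
    near  : ∀ n → LeastDifference x y (suc n) → Cases x y
    apart : x 0 ≢ y 0 → Cases x y

  cases : ∀ x y → Cases x y
  cases x y with em {x ≗ y}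
  ... | yes x≗y = equal x≗y
  ... | no  x≠y with leastDifference em x y x≠y
  ...   | zero  , x0≢y0 , _ = apart x0≢y0
  ...   | suc n , least     = near n least

  apart-⊔ : ∀ {m n : ℕ} → m ≢ n → 1 ≤ m ⊔ n
  apart-⊔ {zero}  {zero}  m≢n = contradiction refl m≢n
  apart-⊔ {zero}  {suc n} _   = s≤s z≤n
  apart-⊔ {suc m} {zero}  _   = s≤s z≤n
  apart-⊔ {suc m} {suc n} _   = s≤s z≤n

  d₀-nonNeg : ∀ x y → 0ℚ ℚ.≤ d₀ em x y
  d₀-nonNeg x y with cases x y
  ... | equal x≗y    = ℚₚ.≤-reflexive (sym (d₀-≗ x≗y))
  ... | near n least = subst (0ℚ ℚ.≤_) (sym (d₀-least least))
    (ℚₚ.<⇒≤ (ℚₚ.positive⁻¹ (½^ (suc n)) {{½^-pos (suc n)}}))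
  ... | apart x0≢y0  = subst (0ℚ ℚ.≤_) (sym (d₀-apart x0≢y0)) (ι-mono {0} {x 0 ⊔ y 0} z≤n)

  agree⇒d₀≤ : ∀ n {x y} → Agree (suc n) x y → d₀ em x y ℚ.≤ ½^ (suc n)
  agree⇒d₀≤ n {x} {y} agree with cases x y
  ... | equal x≗y    = subst (ℚ._≤ ½^ (suc n)) (sym (d₀-≗ x≗y))
    (ℚₚ.<⇒≤ (ℚₚ.positive⁻¹ (½^ (suc n)) {{½^-pos (suc n)}}))
  ... | near m least = subst (ℚ._≤ ½^ (suc n)) (sym (d₀-least least))
    (½^-anti {suc n} {suc m} (≮⇒≥ λ m<n → proj₁ least (agree (suc m) m<n)))
  ... | apart x0≢y0  = contradiction (agree 0 (s≤s z≤n)) x0≢y0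

  d₀≤⇒agree : ∀ n {x y} → d₀ em x y ℚ.≤ ½^ (suc n) → Agree (suc n) x y
  d₀≤⇒agree n {x} {y} le with cases x y
  ... | equal x≗y    = λ i _ → x≗y i
  ... | near m least = agree-mono
    (½^-cancel {suc n} {suc m} (subst (ℚ._≤ ½^ (suc n)) (d₀-least least) le)) (proj₂ least)
  ... | apart x0≢y0  = contradiction
    (ℚₚ.≤-trans (ι-mono (apart-⊔ x0≢y0)) (subst (ℚ._≤ ½^ (suc n)) (d₀-apart x0≢y0) le))
    (ℚ-<⇒≱ (ℚₚ.<-≤-trans (½^-suc-< n) (½^-anti {0} {n} z≤n)))

  d₀≤ι : ∀ {x y n} → 1 ≤ n → (x 0 ≢ y 0 → x 0 ⊔ y 0 ≤ n) → d₀ em x y ℚ.≤ ι n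
  d₀≤ι {x} {y} {n} 1≤n cone with cases x y
  ... | equal x≗y    = subst (ℚ._≤ ι n) (sym (d₀-≗ x≗y)) (ι-mono {0} {n} z≤n)
  ... | near m least = subst (ℚ._≤ ι n) (sym (d₀-least least))
    (ℚₚ.≤-trans (½^-anti {0} {suc m} z≤n) (ι-mono 1≤n))
  ... | apart x0≢y0  = subst (ℚ._≤ ι n) (sym (d₀-apart x0≢y0)) (ι-mono (cone x0≢y0))

  -- Preserved agreement settles points with equal heads. Points with different heads have distance
  -- at least 1, which dominates any two images with a common head, so only images with different
  -- heads need a condition.
  𝖫-criterion : ∀ f →
    (∀ n x y → Agree (suc n) x y → Agree (suc n) (f x) (f y)) →
    (∀ x y → f x 0 ≢ f y 0 → f x 0 ⊔ f y 0 ≤ x 0 ⊔ y 0) →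
    𝖫 (d₀ em) f
  𝖫-criterion f agree cone x y with cases x y
  ... | equal x≗y    = ℚₚ.≤-trans
    (ℚₚ.≤-reflexive (d₀-≗ λ n → agree n x y (λ i _ → x≗y i) n (n<1+n n))) (d₀-nonNeg x y)
  ... | near n least = subst (d₀ em (f x) (f y) ℚ.≤_) (sym (d₀-least least))
    (agree⇒d₀≤ n (agree n x y (proj₂ least)))
  ... | apart x0≢y0  = subst (d₀ em (f x) (f y) ℚ.≤_) (sym (d₀-apart x0≢y0))
    (d₀≤ι (apart-⊔ x0≢y0) (cone x y))

  𝖫𝗂𝗉-bound : ∀ {f} → 𝖫𝗂𝗉 (d₀ em) f →
    ∃ λ l → ∀ x y → d₀ em (f x) (f y) ℚ.≤ ι (2 ^ l) ℚ.* d₀ em x y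
  𝖫𝗂𝗉-bound {f} (L , _ , lip) =
    let M , bound = fromℚ-≤ℝ-· L
    -- `M` becomes an exponent, since `M < 2 ^ M`; a power of two turns the constant into a shift of
    -- digits.
    in M , λ x y → ℚₚ.≤-trans
         (bound (d₀ em (f x) (f y)) (d₀ em x y) (d₀-nonNeg x y) (lip x y))
         (ℚₚ.*-monoʳ-≤-nonNeg (d₀ em x y) {{ℚ.nonNegative (d₀-nonNeg x y)}} (ι-mono (<⇒≤ (n<2^n M))))

  module _ (f : Baire → Baire) l (lip : ∀ x y → d₀ em (f x) (f y) ℚ.≤ ι (2 ^ l) ℚ.* d₀ em x y) where

    -- The factor `2 ^ l` cancels `l` halvings, so at most `l` digits of agreement are lost.
    lipschitz-agree : ∀ n {x y} → Agree (suc (l + n)) x y → Agree (suc n) (f x) (f y)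
    lipschitz-agree n {x} {y} agree = d₀≤⇒agree n {f x} {f y} (begin
      d₀ em (f x) (f y)             ≤⟨ lip x y ⟩
      ι (2 ^ l) ℚ.* d₀ em x y       ≤⟨ ℚₚ.*-monoˡ-≤-nonNeg (ι (2 ^ l)) {{ℚ.nonNegative (ι-mono {0} {2 ^ l} z≤n)}} (agree⇒d₀≤ (l + n) {x} {y} agree) ⟩
      ι (2 ^ l) ℚ.* ½^ (suc l + n)  ≡⟨ cong (λ k → ι (2 ^ l) ℚ.* ½^ k) (+-suc l n) ⟨
      ι (2 ^ l) ℚ.* ½^ (l + suc n)  ≡⟨ 2^*½^ l (suc n) ⟩
      ½^ (suc n)                    ∎)
      where open ℚₚ.≤-Reasoning

    lipschitz-cone : ∀ {x y} → x 0 ≢ y 0 → f x 0 ≢ f y 0 →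
                     f x 0 ⊔ f y 0 ≤ 2 ^ l * (x 0 ⊔ y 0)
    lipschitz-cone {x} {y} x0≢y0 fx0≢fy0 = ι-cancel (subst₂ ℚ._≤_ (d₀-apart {f x} {f y} fx0≢fy0)
      (trans (cong (ι (2 ^ l) ℚ.*_) (d₀-apart {x} {y} x0≢y0)) (ι-* (2 ^ l) (x 0 ⊔ y 0))) (lip x y))

-- Points and Wadge reductions

cons : ℕ → Baire → Baire
cons a x zero    = a
cons a x (suc n) = x n

pad : ℕ → Baire → Baire
pad zero    x = x
pad (suc p) x = cons 0 (pad p x)

drop : ℕ → Baire → Baire
drop p x n = x (p + n)

𝟎 : Baire
𝟎 _ = 0

cons-agree : ∀ {n a b x y} → a ≡ b → Agree n x y → Agree (suc n) (cons a x) (cons b y)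
cons-agree a≡b agree zero    _         = a≡b
cons-agree a≡b agree (suc i) (s≤s i<n) = agree i i<n

pad-agree : ∀ p {n x y} → Agree n x y → Agree (p + n) (pad p x) (pad p y)
pad-agree zero    agree = agree
pad-agree (suc p) agree = cons-agree refl (pad-agree p agree)

drop-agree : ∀ p {n x y} → Agree (p + n) x y → Agree n (drop p x) (drop p y)
drop-agree p agree i i<n = agree (p + i) (+-monoʳ-< p i<n)

drop-pad : ∀ p x → drop p (pad p x) ≗ x
drop-pad zero    x n = refl
drop-pad (suc p) x n = drop-pad p x n

drop-+-pad : ∀ p q x → drop (p + q) (pad p x) ≗ drop q x
drop-+-pad p q x n = trans (cong (pad p x) (+-assoc p q n)) (drop-pad p x (q + n))

𝖶-cons : ∀ a → 𝖶 (cons a)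
𝖶-cons a x n = n , λ y agree → agree-mono (n≤1+n n) (cons-agree refl agree)

𝖶-pad : ∀ p → 𝖶 (pad p)
𝖶-pad p x n = n , λ y agree → agree-mono (m≤n+m n p) (pad-agree p agree)

𝖶-drop : ∀ p → 𝖶 (drop p)
𝖶-drop p x n = p + n , λ y → drop-agree p

𝖶-∘ : ∀ {f g} → 𝖶 f → 𝖶 g → 𝖶 (f ∘ g)
𝖶-∘ {g = g} f-cont g-cont x n =
  let m , f-agree = f-cont (g x) n
      k , g-agree = g-cont x m
  in k , λ y agree → f-agree (g y) (g-agree y agree)

𝖶-byHead : ∀ {g : ℕ → Baire → Baire} → (∀ a → 𝖶 (g a)) → 𝖶 (λ x → g (x 0) x)
𝖶-byHead {g} cont x n =
  let m , g-agree = cont (x 0) x n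
  -- The additional digit forces `y` to have the head of `x`, so both points use the same `g a`.
  in suc m , λ y agree → subst (λ a → Agree n (g (x 0) x) (g a y)) (agree 0 (s≤s z≤n))
       (g-agree y (agree-mono (n≤1+n m) agree))

≤[𝖶]-trans : ∀ {A B C} → A ≤[ 𝖶 ] B → B ≤[ 𝖶 ] C → A ≤[ 𝖶 ] C
≤[𝖶]-trans (f , f-cont , A⊆ , ⊆A) (g , g-cont , B⊆ , ⊆B) =
  g ∘ f , 𝖶-∘ g-cont f-cont , B⊆ ∘ A⊆ , ⊆A ∘ ⊆B

module _ (g : Baire → Baire) (contract : ∀ n {x y} → Agree n x y → Agree (suc n) (g x) (g y)) where

  private
    iter : ℕ → Baire
    iter zero    = 𝟎
    iter (suc n) = g (iter n)

    iter-agree : ∀ n → Agree n (iter n) (iter (suc n))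
    iter-agree zero    _ ()
    iter-agree (suc n) = contract n (iter-agree n)

    iter-stable : ∀ i k → iter (suc i) i ≡ iter (k + suc i) i
    iter-stable i zero    = refl
    iter-stable i (suc k) = trans (iter-stable i k) (iter-agree (k + suc i) i (m≤n+m (suc i) k))

  -- Digit `i` no longer changes from `iter (suc i)` on, and `limit` reads it there. Since `limit`
  -- and `iter n` agree below `n`, contraction makes `g limit` and `iter (suc n)` agree at `n`.
  fixedPoint : ∃ λ x → g x ≗ x
  fixedPoint = limit , λ n → contract n (λ i i<n →
      trans (iter-stable i (n ∸ suc i)) (cong (λ k → iter k i) (m∸n+n≡m i<n)))
    n (n<1+n n)
    where
    limit : Baire
    limit i = iter (suc i) i

-- The selfdual set A ⊕ Aᶜ

module Sum (em : ExcludedMiddle 0ℓ) (A : Pointset) where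

  Side : ℕ → Pred Baire 0ℓ
  Side zero    = member A
  Side (suc _) = ∁ (member A)

  side-resp : ∀ a {x y} → x ≗ y → Side a x → Side a y
  side-resp zero    = respects A
  side-resp (suc _) = respects (A ᶜ)

  A⊕Aᶜ : Pointset
  A⊕Aᶜ = mkPointset (λ x → Side (x 0) (drop 1 x)) λ {x} {y} x≗y x∈ →
    subst (λ a → Side a (drop 1 y)) (x≗y 0) (side-resp (x 0) (λ n → x≗y (suc n)) x∈)

  other : ℕ → ℕ
  other zero    = 1
  other (suc _) = 0

  -- Every nonzero head marks the side of the complement, so `swap` may merge heads; it still
  -- preserves initial agreement and therefore keeps `swap ∘ g` a contraction.
  swap : Baire → Baire
  swap x = cons (other (x 0)) (drop 1 x)

  swap-agree : ∀ n {x y} → Agree n x y → Agree n (swap x) (swap y)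
  swap-agree zero    _     _ ()
  swap-agree (suc n) agree = cons-agree (cong other (agree 0 (s≤s z≤n))) (drop-agree 1 agree)

  swap-∉ : ∀ x → member A⊕Aᶜ x → ¬ member A⊕Aᶜ (swap x)
  swap-∉ x = go (x 0)
    where
    go : ∀ a → Side a (drop 1 x) → ¬ Side (other a) (drop 1 x)
    go zero    ∈A ∉A = ∉A ∈A
    go (suc _) ∉A ∈A = ∉A ∈A

  swap-∉⁻ : ∀ x → ¬ member A⊕Aᶜ (swap x) → member A⊕Aᶜ x
  swap-∉⁻ x = go (x 0)
    where
    go : ∀ a → ¬ Side (other a) (drop 1 x) → Side a (drop 1 x)
    go zero    ¬∉A = decidable-stable em ¬∉A
    go (suc _) ∉A  = ∉A

  no-contraction : ∀ g → (∀ n {x y} → Agree n x y → Agree (suc n) (g x) (g y)) →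
                   ¬ (member A⊕Aᶜ ≐ g ⊢ member A⊕Aᶜ)
  no-contraction g contract (to , from) = x∉ x∈
    where
    fix = fixedPoint (swap ∘ g) (λ n agree → swap-agree (suc n) (contract n agree))
    x   = proj₁ fix

    x∉ : ¬ member A⊕Aᶜ x
    x∉ x∈ = swap-∉ (g x) (to x∈) (respects A⊕Aᶜ (λ n → sym (proj₂ fix n)) x∈)

    x∈ : member A⊕Aᶜ x
    x∈ = from (swap-∉⁻ (g x) (x∉ ∘ respects A⊕Aᶜ (proj₂ fix)))

  A≤A⊕Aᶜ : A ≤[ 𝖶 ] A⊕Aᶜ
  A≤A⊕Aᶜ = cons 0 , 𝖶-cons 0 , (λ x∈ → x∈) , (λ x∈ → x∈)

  -- Selfduality enters here: a reduction of `A` to its complement also reduces the complement to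
  -- `A`, so it handles the nonzero heads.
  A⊕Aᶜ≤A : 𝖶-selfdual A → A⊕Aᶜ ≤[ 𝖶 ] A
  A⊕Aᶜ≤A (f , f-cont , to , from) =
    (λ x → g (x 0) x) , 𝖶-byHead g-cont , (λ {x} → g-to (x 0) x) , (λ {x} → g-from (x 0) x)
    where
    g : ℕ → Baire → Baire
    g zero    x = drop 1 x
    g (suc _) x = f (drop 1 x)

    g-cont : ∀ a → 𝖶 (g a)
    g-cont zero    = 𝖶-drop 1
    g-cont (suc _) = 𝖶-∘ f-cont (𝖶-drop 1)

    g-to : ∀ a x → Side a (drop 1 x) → member A (g a x)
    g-to zero    x x∈ = x∈
    g-to (suc _) x x∉ = decidable-stable em λ fx∉ → x∉ (from fx∉)

    g-from : ∀ a x → member A (g a x) → Side a (drop 1 x)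
    g-from zero    x x∈  = x∈
    g-from (suc _) x fx∈ x∈ = to x∈ fx∈

  -- Copies of `A⊕Aᶜ` behind irrelevant digits, one in each cone

  Spread : (ℕ → ℕ) → Pointset
  Spread e = mkPointset (λ x → member A⊕Aᶜ (drop (suc (e (x 0))) x)) λ {x} {y} x≗y x∈ →
    subst (λ a → member A⊕Aᶜ (drop (suc (e a)) y)) (x≗y 0)
      (respects A⊕Aᶜ (λ n → x≗y (suc (e (x 0)) + n)) x∈)

  prefix : (ℕ → ℕ) → ℕ → Baire → Baire
  prefix e a x = cons a (pad (e a) x)

  Spread-prefix : ∀ e a → member A⊕Aᶜ ≐ prefix e a ⊢ member (Spread e)
  Spread-prefix e a =
    (λ {x} → respects A⊕Aᶜ (λ n → sym (drop-pad (e a) x n))) ,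
    (λ {x} → respects A⊕Aᶜ (drop-pad (e a) x))

  Spread-≗ : ∀ {e e′} → e ≗ e′ → ∀ {x} → member (Spread e) x → member (Spread e′) x
  Spread-≗ e≗e′ {x} = subst (λ k → member A⊕Aᶜ (drop (suc k) x)) (e≗e′ (x 0))

  Spread∈[A]𝖶 : 𝖶-selfdual A → (ℕ → ℕ) → [ A ]𝖶
  Spread∈[A]𝖶 sd e = mkMember (Spread e)
    ( ≤[𝖶]-trans {Spread e} {A⊕Aᶜ} {A}
        ((λ x → drop (suc (e (x 0))) x) , 𝖶-byHead (λ a → 𝖶-drop (suc (e a))) , (λ x∈ → x∈) , (λ x∈ → x∈))
        (A⊕Aᶜ≤A sd)
    , ≤[𝖶]-trans {A} {A⊕Aᶜ} {Spread e} A≤A⊕Aᶜ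
        (prefix e 0 , 𝖶-∘ (𝖶-cons 0) (𝖶-pad (e 0)) , Spread-prefix e 0))

  open Metric em

  -- Cone `a` is mapped into cone `a ⊔ N`. Heads up to `N` become equal and larger ones stay put, so
  -- heads that remain different have the same maximum as before.
  Spread-mono : ∀ {e e′} N → (∀ a → e a ≤ e′ (a ⊔ N)) → Spread e ≤[ 𝖫 (d₀ em) ] Spread e′
  Spread-mono {e} {e′} N e≤e′ =
    f , 𝖫-criterion f f-agree cone ,
    (λ {x} → respects A⊕Aᶜ (λ n → sym (f-drop x n))) , (λ {x} → respects A⊕Aᶜ (f-drop x))
    where
    gap : ℕ → ℕ
    gap a = e′ (a ⊔ N) ∸ e a

    -- The tail keeps its own `e (x 0)` irrelevant digits, so only the difference is inserted;
    -- digits are delayed, never advanced.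
    f : Baire → Baire
    f x = cons (x 0 ⊔ N) (pad (gap (x 0)) (drop 1 x))

    f-drop : ∀ x → drop (suc (e′ (x 0 ⊔ N))) (f x) ≗ drop (suc (e (x 0))) x
    f-drop x n = trans
      (cong (λ k → pad (gap (x 0)) (drop 1 x) (k + n)) (sym (m∸n+n≡m (e≤e′ (x 0)))))
      (drop-+-pad (gap (x 0)) (e (x 0)) (drop 1 x) n)

    f-agree : ∀ n x y → Agree (suc n) x y → Agree (suc n) (f x) (f y)
    f-agree n x y agree = cons-agree (cong (_⊔ N) x0≡y0)
      (subst (λ a → Agree n (pad (gap (x 0)) (drop 1 x)) (pad (gap a) (drop 1 y))) x0≡y0
        (agree-mono (m≤n+m n (gap (x 0))) (pad-agree (gap (x 0)) (drop-agree 1 agree))))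
      where x0≡y0 = agree 0 (s≤s z≤n)

    ⊔-cone : ∀ {a b} → a ≤ b → a ⊔ N ≢ b ⊔ N → (a ⊔ N) ⊔ (b ⊔ N) ≤ b
    ⊔-cone {a} {b} a≤b neq with ≤-total b N
    ... | inj₁ b≤N = contradiction
      (trans (m≤n⇒m⊔n≡n (≤-trans a≤b b≤N)) (sym (m≤n⇒m⊔n≡n b≤N))) neq
    ... | inj₂ N≤b = ⊔-lub (⊔-lub a≤b N≤b) (⊔-lub ≤-refl N≤b)

    cone : ∀ x y → x 0 ⊔ N ≢ y 0 ⊔ N → (x 0 ⊔ N) ⊔ (y 0 ⊔ N) ≤ x 0 ⊔ y 0
    cone x y neq with ≤-total (x 0) (y 0)
    ... | inj₁ x0≤y0 = ≤-trans (⊔-cone x0≤y0 neq) (m≤n⊔m (x 0) (y 0))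
    ... | inj₂ y0≤x0 = ≤-trans (≤-reflexive (⊔-comm (x 0 ⊔ N) (y 0 ⊔ N)))
      (≤-trans (⊔-cone y0≤x0 (neq ∘ sym)) (m≤m⊔n (x 0) (y 0)))

  -- Otherwise f, preceded by the padding of cone a and followed by the removal of
  -- the padding in the target cone, would be a strict contraction reducing A ⊕ Aᶜ
  -- to itself.
  Spread-lipschitz : ∀ {e e′} f → member (Spread e) ≐ f ⊢ member (Spread e′) →
    ∀ {l} → (∀ x y → d₀ em (f x) (f y) ℚ.≤ ι (2 ^ l) ℚ.* d₀ em x y) →
    ∀ a → e a ≤ l + e′ (f (prefix e a 𝟎) 0)
  Spread-lipschitz {e} {e′} f (to , from) {l} lip a = ≮⇒≥ λ l+e′<e →
    no-contraction g (g-contract l+e′<e)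
      ( (λ {x} x∈ → subst (inner x) (head l+e′<e x) (to (proj₁ (Spread-prefix e a) x∈)))
      , (λ {x} gx∈ → proj₂ (Spread-prefix e a) (from (subst (inner x) (sym (head l+e′<e x)) gx∈))))
    where
    c = f (prefix e a 𝟎) 0

    g : Baire → Baire
    g x = drop (suc (e′ c)) (f (prefix e a x))

    -- The head of the image is made a variable, so that `head` can replace it by `c`.
    inner : Baire → ℕ → Set
    inner x b = member A⊕Aᶜ (drop (suc (e′ b)) (f (prefix e a x)))

    -- Of `suc (e a + n)` common digits, `l` may be lost. As `l + e′ c < e a`, at least
    -- `suc (suc (e′ c) + n)` remain, and removing `suc (e′ c)` of them leaves one more than `n`.
    f-agree : l + e′ c < e a → ∀ n x y → Agree n x y →
              Agree (suc (suc (e′ c) + n)) (f (prefix e a x)) (f (prefix e a y))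
    f-agree l+e′<e n x y agree = lipschitz-agree f l lip (suc (e′ c) + n)
      (agree-mono
        (s≤s (≤-trans (≤-reflexive (trans (sym (+-assoc l (suc (e′ c)) n)) (cong (_+ n) (+-suc l (e′ c)))))
          (+-monoˡ-≤ n l+e′<e)))
        (cons-agree {x = pad (e a) x} {pad (e a) y} refl (pad-agree (e a) agree)))

    -- With `n = 0` the common prefix alone fixes the head of the image, so every `prefix e a x` is
    -- sent into cone `c`.
    head : l + e′ c < e a → ∀ x → f (prefix e a x) 0 ≡ c
    head l+e′<e x = f-agree l+e′<e 0 x 𝟎 (λ _ ()) 0 (s≤s z≤n)

    g-contract : l + e′ c < e a → ∀ n {x y} → Agree n x y → Agree (suc n) (g x) (g y)
    g-contract l+e′<e n {x} {y} agree = drop-agree (suc (e′ c))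
      (subst (λ k → Agree k (f (prefix e a x)) (f (prefix e a y))) (sym (+-suc (suc (e′ c)) n))
        (f-agree l+e′<e n x y agree))

-- Padding lengths

-- Induction by halving, which lowers both the logarithm and the exponent by one.
⌊log₂⌋-< : ∀ k {n} → n < 2 ^ suc k → ⌊log₂ n ⌋ ≤ k
⌊log₂⌋-< zero    n<2 = ⌊log₂⌋-mono-≤ (s≤s⁻¹ n<2)
⌊log₂⌋-< (suc k) {n} n<2^ = begin
  ⌊log₂ n ⌋              ≤⟨ m≤n+m∸n ⌊log₂ n ⌋ 1 ⟩
  suc (⌊log₂ n ⌋ ∸ 1)    ≡⟨ cong suc (⌊log₂⌊n/2⌋⌋≡⌊log₂n⌋∸1 n) ⟨
  suc ⌊log₂ ⌊ n /2⌋ ⌋    ≤⟨ s≤s (⌊log₂⌋-< k (≰⇒> λ 2^≤n/2 → <⇒≱ n<2^ (2*≤ 2^≤n/2))) ⟩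
  suc k                  ∎
  where
  open ≤-Reasoning
  2*≤ : ∀ {m} → m ≤ ⌊ n /2⌋ → 2 * m ≤ n
  2*≤ {m} m≤n/2 = begin
    m + (m + 0)            ≡⟨ cong (_+_ m) (+-identityʳ m) ⟩
    m + m                  ≤⟨ +-mono-≤ m≤n/2 (≤-trans m≤n/2 (⌊n/2⌋≤⌈n/2⌉ n)) ⟩
    ⌊ n /2⌋ + ⌈ n /2⌉      ≡⟨ ⌊n/2⌋+⌈n/2⌉≡n n ⟩
    n                      ∎

-- β is unbounded, but so slow that multiplying 2 ^ 2 ^ k by any fixed factor
-- does not change its value, for k large.
β : ℕ → ℕ
β n = ⌊log₂ ⌊log₂ n ⌋ ⌋

β-mono : ∀ {m n} → m ≤ n → β m ≤ β n
β-mono m≤n = ⌊log₂⌋-mono-≤ (⌊log₂⌋-mono-≤ m≤n)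

β-2^2^ : ∀ k → β (2 ^ 2 ^ k) ≡ k
β-2^2^ k = trans (cong ⌊log₂_⌋ (⌊log₂[2^n]⌋≡n (2 ^ k))) (⌊log₂[2^n]⌋≡n k)

-- Since `l ≤ k < 2 ^ k`, the inner logarithm `l + 2 ^ k` stays below `2 ^ suc k`.
β-slow : ∀ {l k} → l ≤ k → β (2 ^ l * 2 ^ 2 ^ k) ≤ k
β-slow {l} {k} l≤k = ⌊log₂⌋-< k (begin-strict
  ⌊log₂ 2 ^ l * 2 ^ 2 ^ k ⌋  ≡⟨ cong ⌊log₂_⌋ (^-distribˡ-+-* 2 l (2 ^ k)) ⟨
  ⌊log₂ 2 ^ (l + 2 ^ k) ⌋    ≡⟨ ⌊log₂[2^n]⌋≡n (l + 2 ^ k) ⟩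
  l + 2 ^ k                  <⟨ +-monoˡ-< (2 ^ k) (≤-<-trans l≤k (n<2^n k)) ⟩
  2 ^ k + 2 ^ k              ≡⟨ cong (_+_ (2 ^ k)) (+-identityʳ (2 ^ k)) ⟨
  2 ^ suc k                  ∎)
  where open ≤-Reasoning

-- `n * n` exceeds `m * m` by at least `n`. Once levels exceed `l`, a single step of level thus
-- outweighs the `l` digits that a Lipschitz reduction may lose.
square-gap : ∀ {l m n} → l < n → m < n → l + m * m < n * n
square-gap {l} {m} {n} l<n m<n = begin-strict
  l + m * m  <⟨ +-mono-<-≤ l<n (*-monoˡ-≤ m (<⇒≤ m<n)) ⟩
  n + n * m  ≡⟨ *-suc n m ⟨
  n * suc m  ≤⟨ *-monoʳ-≤ n m<n ⟩
  n * n      ∎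
  where open ≤-Reasoning

module Padding (em : ExcludedMiddle 0ℓ) where

  χ : Pred ℕ 0ℓ → ℕ → ℕ
  χ X k = if does (em {X k}) then 1 else 0

  χ-mono : ∀ {X Y : Pred ℕ 0ℓ} {k} → (X k → Y k) → χ X k ≤ χ Y k
  χ-mono {X} {Y} {k} X⊆Y with em {X k} | em {Y k}
  ... | no  _  | _      = z≤n
  ... | yes _  | yes _  = ≤-refl
  ... | yes Xk | no ¬Yk = contradiction (X⊆Y Xk) ¬Yk

  χ-≐ : ∀ {X Y : Pred ℕ 0ℓ} → X ≐ Y → ∀ k → χ X k ≡ χ Y k
  χ-≐ {X} {Y} (X⊆Y , Y⊆X) k = ≤-antisym (χ-mono {X} {Y} X⊆Y) (χ-mono {Y} {X} Y⊆X)

  χ≤1 : ∀ (X : Pred ℕ 0ℓ) k → χ X k ≤ 1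
  χ≤1 X k with em {X k}
  ... | yes _ = ≤-refl
  ... | no  _ = z≤n

  χ-∈ : ∀ {X : Pred ℕ 0ℓ} {k} → X k → χ X k ≡ 1
  χ-∈ {X} {k} Xk with em {X k}
  ... | yes _  = refl
  ... | no ¬Xk = contradiction Xk ¬Xk

  χ-∉ : ∀ {X : Pred ℕ 0ℓ} {k} → ¬ X k → χ X k ≡ 0
  χ-∉ {X} {k} ¬Xk with em {X k}
  ... | yes Xk = contradiction Xk ¬Xk
  ... | no  _  = refl

  -- The possible values at `k` are `2 * k` and `1 + 2 * k`, so levels at different arguments are
  -- ordered as the arguments, whatever the two sets are; membership decides only at equal
  -- arguments.
  level : Pred ℕ 0ℓ → ℕ → ℕ
  level X k = χ X k + 2 * k

  level-<-suc : ∀ (X : Pred ℕ 0ℓ) k → level X k < 2 * suc k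
  level-<-suc X k = begin-strict
    χ X k + 2 * k  <⟨ +-monoˡ-< (2 * k) (s≤s (χ≤1 X k)) ⟩
    2 + 2 * k      ≡⟨ *-suc 2 k ⟨
    2 * suc k      ∎
    where open ≤-Reasoning

  level-<-mono : ∀ (X Y : Pred ℕ 0ℓ) {j k} → j < k → level X j < level Y k
  level-<-mono X Y {j} {k} j<k = <-≤-trans (level-<-suc X j)
    (≤-trans (*-monoʳ-≤ 2 j<k) (m≤n+m (2 * k) (χ Y k)))

  level-mono : ∀ (X : Pred ℕ 0ℓ) {j k} → j ≤ k → level X j ≤ level X k
  level-mono X j≤k with m≤n⇒m<n∨m≡n j≤k
  ... | inj₁ j<k  = <⇒≤ (level-<-mono X X j<k)
  ... | inj₂ refl = ≤-refl

  level-∈-∉ : ∀ {X Y : Pred ℕ 0ℓ} {j k} → j ≤ k → X k → ¬ Y k → level Y j < level X k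
  level-∈-∉ {X} {Y} {j} {k} j≤k Xk ¬Yk with m≤n⇒m<n∨m≡n j≤k
  ... | inj₁ j<k  = level-<-mono Y X j<k
  ... | inj₂ refl = +-monoˡ-< (2 * k) (subst₂ _<_ (sym (χ-∉ {Y} ¬Yk)) (sym (χ-∈ {X} Xk)) (s≤s z≤n))

  padding : Pred ℕ 0ℓ → ℕ → ℕ
  padding X n = level X (β n) * level X (β n)

  padding-≐ : ∀ {X Y : Pred ℕ 0ℓ} → X ≐ Y → padding X ≗ padding Y
  padding-≐ X≐Y n = cong (λ c → (c + 2 * β n) * (c + 2 * β n)) (χ-≐ X≐Y (β n))

  -- Raising `n` to at least `2 ^ 2 ^ N` brings `β` up to `N`, so `Y` is consulted only where the
  -- inclusion holds.
  padding-mono : ∀ {X Y : Pred ℕ 0ℓ} N → (∀ {k} → N ≤ k → X k → Y k) →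
                 ∀ n → padding X n ≤ padding Y (n ⊔ 2 ^ 2 ^ N)
  padding-mono {X} {Y} N X⊆Y n = *-mono-≤ le le
    where
    m = n ⊔ 2 ^ 2 ^ N

    N≤βm : N ≤ β m
    N≤βm = subst (_≤ β m) (β-2^2^ N) (β-mono (m≤n⊔m n (2 ^ 2 ^ N)))

    le : level X (β n) ≤ level Y (β m)
    le = ≤-trans (level-mono X (β-mono (m≤m⊔n n (2 ^ 2 ^ N))))
           (+-monoˡ-≤ (2 * β m) (χ-mono {X} {Y} (X⊆Y N≤βm)))

  -- The bound on `c` gives `β c ≤ k`. Below `k` levels are smaller anyway; at `k` membership in `X`
  -- but not in `Y` separates them, and squaring widens the gap beyond `l`.
  padding-gap : ∀ {X Y : Pred ℕ 0ℓ} {l k c} → l ≤ k → c ≤ 2 ^ l * 2 ^ 2 ^ k → X k → ¬ Y k →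
                l + padding Y c < padding X (2 ^ 2 ^ k)
  padding-gap {X} {Y} {l} {k} {c} l≤k c≤ Xk ¬Yk =
    subst (λ j → l + padding Y c < level X j * level X j) (sym (β-2^2^ k))
      (square-gap
        -- Membership in `X` supplies the 1 that gives `l < 1 + 2 * k` even when `l = k = 0`.
        (subst (λ i → l < i + 2 * k) (sym (χ-∈ {X} Xk)) (s≤s (≤-trans l≤k (m≤m+n k (k + 0)))))
        (level-∈-∉ {X} {Y} (≤-trans (β-mono c≤) (β-slow l≤k)) Xk ¬Yk))

-- The embedding of the subsets of ω, ordered by almost inclusion

theorem5p4 : (em : ExcludedMiddle 0ℓ) (A : Pointset) → 𝖶-selfdual A →
    Σ[ ψ ∈ (Pred ℕ 0ℓ → [ A ]𝖶) ]
    (∀ X Y → X ≐ Y → member ⟦ ψ X ⟧ ≐ member ⟦ ψ Y ⟧) ×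
    (∀ X Y →
    (X ⊆* Y → ⟦ ψ X ⟧ ≤[ 𝖫 (d₀ em) ] ⟦ ψ Y ⟧) ×
    (⟦ ψ X ⟧ ≤[ 𝖫𝗂𝗉 (d₀ em) ] ⟦ ψ Y ⟧ → X ⊆* Y))
theorem5p4 em A sd = (λ X → Spread∈[A]𝖶 sd (padding X)) , respects-≐ , λ X Y → forward X Y , backward X Y
  where
  open Metric em
  open Sum em A
  open Padding em

  respects-≐ : ∀ X Y → X ≐ Y → member (Spread (padding X)) ≐ member (Spread (padding Y))
  respects-≐ X Y X≐Y =
    (λ {x} → Spread-≗ {padding X} {padding Y} (padding-≐ X≐Y) {x}) ,
    (λ {x} → Spread-≗ {padding Y} {padding X} (λ n → sym (padding-≐ X≐Y n)) {x})

  forward : ∀ X Y → X ⊆* Y → Spread (padding X) ≤[ 𝖫 (d₀ em) ] Spread (padding Y)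
  forward X Y (xs , X∖Y⊆xs , _) = Spread-mono {padding X} {padding Y} (2 ^ 2 ^ N) (padding-mono {X} {Y} N X⊆Y)
    where
    -- `N` lies past every element of `xs`; the default 0 covers the empty list.
    N = suc (max 0 xs)

    X⊆Y : ∀ {k} → N ≤ k → X k → Y k
    X⊆Y N≤k Xk = decidable-stable em λ ¬Yk →
      <⇒≱ N≤k (All.lookup (xs≤max 0 xs) (X∖Y⊆xs (Xk , ¬Yk)))

  backward : ∀ X Y → Spread (padding X) ≤[ 𝖫𝗂𝗉 (d₀ em) ] Spread (padding Y) → X ⊆* Y
  backward X Y (f , f-lip , reduces) =
    -- The difference lies below `K`; filtering makes the list exact, as `Finite` asks for equality.
    filter X∖Y? (upTo K) ,
    (λ k∈ → ∈-filter⁺ X∖Y? (∈-upTo⁺ (≰⇒> λ K≤k → small K≤k k∈)) k∈) ,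
    (λ k∈ → proj₂ (∈-filter⁻ X∖Y? {xs = upTo K} k∈))
    where
    X∖Y? : ∀ k → Dec ((X ∖ Y) k)
    X∖Y? _ = em

    l = proj₁ (𝖫𝗂𝗉-bound {f} f-lip)
    lip = proj₂ (𝖫𝗂𝗉-bound {f} f-lip)

    -- `l ≤ k` is required by `padding-gap`, and `f 𝟎 0 ≤ k` bounds `c` when it equals the head of
    -- `f 𝟎`.
    K = l ⊔ f 𝟎 0

    small : ∀ {k} → K ≤ k → ¬ (X ∖ Y) k
    small {k} K≤k (Xk , ¬Yk) = <⇒≱ (padding-gap {X} {Y} l≤k c≤2^l*a Xk ¬Yk)
      (Spread-lipschitz {padding X} {padding Y} f reduces {l} lip a)
      where
      l≤k = ≤-trans (m≤m⊔n l (f 𝟎 0)) K≤k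
      a   = 2 ^ 2 ^ k
      x   = prefix (padding X) a 𝟎
      c   = f x 0

      a≤2^l*a : a ≤ 2 ^ l * a
      a≤2^l*a = ≤-trans (≤-reflexive (sym (*-identityˡ a))) (*-monoˡ-≤ a (m^n>0 2 l))

      -- Comparison with `𝟎`, whose head differs from `a`: either the images share a head, and `c`
      -- is the fixed number `f 𝟎 0`, or `lipschitz-cone` applies.
      c≤2^l*a : c ≤ 2 ^ l * a
      c≤2^l*a with c ≟ f 𝟎 0
      ... | yes c≡f𝟎0 = begin
        c            ≡⟨ c≡f𝟎0 ⟩
        f 𝟎 0        ≤⟨ m≤n⊔m l (f 𝟎 0) ⟩
        K            ≤⟨ K≤k ⟩
        k            ≤⟨ <⇒≤ (<-trans (n<2^n k) (n<2^n (2 ^ k))) ⟩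
        a            ≤⟨ a≤2^l*a ⟩
        2 ^ l * a    ∎
        where open ≤-Reasoning
      ... | no  c≢f𝟎0 = begin
        c                  ≤⟨ m≤m⊔n c (f 𝟎 0) ⟩
        c ⊔ f 𝟎 0          ≤⟨ lipschitz-cone f l lip {x} {𝟎} (>⇒≢ (m^n>0 2 (2 ^ k))) c≢f𝟎0 ⟩
        2 ^ l * (a ⊔ 0)    ≡⟨ cong (2 ^ l *_) (⊔-identityʳ a) ⟩
        2 ^ l * a          ∎
        where open ≤-Reasoning
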